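{- Let $P_1,\ldots,P_r\in\mathbb{Z}^2$ be distinct lattice points and let $\mathcal{S}=\mathcal{S}(P_1,\ldots,P_r)=\{Q\in\mathbb{Z}^2 : |Q-P_i|\in\mathbb{Z}\ \text{for } i=1,\ldots,r\}$. (1) If $r=2$, the set $\mathcal{S}(P_1,P_2)$ is contained in the union of finitely many hyperbolas, the line through $P_1$ and $P_2$, and the line of points equidistant from $P_1$ and $P_2$. (2) If $r\ge 3$, the set $\mathcal{S}$ is finite and effectively computable, unless all the $P_i$ are collinear and all mutual distances $|P_i-P_j|$ are integers; in that latter case, all but finitely many points of $\mathcal{S}$ lie on the line $P_1P_2$.
   Context: $|\cdot|$ denotes the usual Euclidean norm on $\mathbb{R}^2$, so $|Q-P|$ is the Euclidean distance between $P$ and $Q$. A lattice point is a point of $\mathbb{Z}^2$. -}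

module Defs where

open import Data.Nat using (ℕ; zero; suc; _≤_; s≤s; z≤n)
open import Data.Integer using (ℤ; +_; _+_; _-_; _*_; _<_)
open import Data.Fin using (Fin; zero; suc)
open import Data.Nat using (_≤_)
open import Data.Product using (_×_; _,_; proj₁; proj₂; ∃-syntax)
open import Relation.Binary.PropositionalEquality using (_≡_; _≢_)

Point : Set
Point = ℤ × ℤ

sqDist : Point → Point → ℤ
sqDist (px , py) (qx , qy) = (qx - px) * (qx - px) + (qy - py) * (qy - py)

IntDist : Point → Point → Set
IntDist P Q = ∃[ k ] sqDist P Q ≡ + (k Data.Nat.* k)

Collinear : Point → Point → Point → Set
Collinear (ax , ay) (bx , by) (cx , cy) =
  (bx - ax) * (cy - ay) - (by - ay) * (cx - ax) ≡ + 0

Equidistant : Point → Point → Point → Set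
Equidistant A B Q = sqDist A Q ≡ sqDist B Q

InS : ∀ {r} → (Fin r → Point) → Point → Set
InS {r} P Q = (i : Fin r) → IntDist (P i) Q

record Conic : Set where
  constructor conic
  field a b c d e f : ℤ

-- Real-affine hyperbola: discriminant b² - 4ac > 0 and nondegenerate
-- (determinant of [[2a,b,d],[b,2c,e],[d,e,2f]] nonzero).
IsHyperbola : Conic → Set
IsHyperbola (conic a b c d e f) =
  (+ 0 < b * b - + 4 * a * c) ×
  (+ 2 * a * (+ 4 * c * f - e * e) - b * (+ 2 * b * f - d * e)
     + d * (b * e - + 2 * c * d) ≢ + 0)

OnConic : Conic → Point → Set
OnConic (conic a b c d e f) (x , y) =
  a * x * x + b * x * y + c * y * y + d * x + e * y + f ≡ + 0

idx1 : ∀ {r} → 3 ≤ r → Fin r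
idx1 {suc (suc (suc _))} (s≤s (s≤s (s≤s _))) = zero

idx2 : ∀ {r} → 3 ≤ r → Fin r
idx2 {suc (suc (suc _))} (s≤s (s≤s (s≤s _))) = suc zero

-- Heron's formula for a triangle P₁P₂Q with |QP₁| = a, |QP₂| = b and |P₁P₂|² = d reads
-- 4·(2·area)² = (d − (a − b)²)((a + b)² − d), so (a − b)² ≤ d, with equality exactly when Q lies on
-- the line P₁P₂. Otherwise either a = b, or Q lies on the hyperbola | |QP₁| − |QP₂| | = |a − b| with
-- foci P₁ and P₂, and there are fewer than d such hyperbolas.
--
-- For three points A, B, C put α = |AQ|, k = α − |BQ| and m = α − |CQ|; by the above, |k| and |m| are
-- bounded in terms of A, B, C alone. The dot products of Q − A with B − A and C − A are linear in α,
-- with coefficients depending on k and m. If A, B, C are not collinear, Cramer's rule recovers Q − A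
-- from them, and |Q − A|² = α² becomes a quadratic equation in α that does not vanish identically, so
-- α, and with it Q, is bounded. If they are collinear, the elimination leaves a linear equation in α
-- which vanishes identically only when k² = |AB|², that is, when Q lies on the line AB; this cannot
-- happen if |AB| is not an integer. A bounded part of S is listed by filtering a box of lattice
-- points, S being decidable.

module Submission where

open import Defs
open import Data.Nat as ℕ using (ℕ; zero; suc; pred; _≤_; _<_; _≤?_; s≤s)
import Data.Nat.Properties as ℕₚ
open import Data.Nat.ListAction using (sum)
open import Data.Integer as ℤ using (ℤ; +_; -[1+_]; ∣_∣; _+_; _*_; _-_; -_)
import Data.Integer.Properties as ℤₚ
open import Data.Integer.Tactic.RingSolver using (solve-∀; solve)
open import Data.Fin using (Fin; zero; suc)
open import Data.Fin.Properties using (all?; any?)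
open import Data.List using (List; []; _∷_; map; filter; applyUpTo; cartesianProduct)
open import Data.List.Relation.Unary.All using (All)
open import Data.List.Relation.Unary.All.Properties using (applyUpTo⁺₁)
open import Data.List.Relation.Unary.Any using (Any; here; there)
open import Data.List.Relation.Unary.Any.Properties using (applyUpTo⁺)
open import Data.List.Membership.Propositional using (_∈_)
open import Data.List.Membership.Propositional.Properties
  using (∈-applyUpTo⁺; ∈-cartesianProduct⁺; ∈-filter⁺; ∈-filter⁻)
open import Data.Product using (_×_; _,_; proj₁; proj₂; Σ-syntax; ∃-syntax)
open import Data.Sum using (_⊎_; inj₁; inj₂; [_,_]′; swap)
open import Data.Empty using (⊥; ⊥-elim)
open import Function using (id; _∘_)
open import Function.Definitions using (Injective)
open import Relation.Binary.PropositionalEquality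
open import Relation.Nullary using (¬_; Dec; yes; no)
open import Relation.Nullary.Decidable using (map′; ¬?; decidable-stable)

i*i≡+∣i∣*∣i∣ : ∀ i → i * i ≡ + (∣ i ∣ ℕ.* ∣ i ∣)
i*i≡+∣i∣*∣i∣ (+ n)    = sym (ℤₚ.pos-* n n)
i*i≡+∣i∣*∣i∣ -[1+ n ] = refl

i*i≡0⇒i≡0 : ∀ i → i * i ≡ + 0 → i ≡ + 0
i*i≡0⇒i≡0 i eq = [ id , id ]′ (ℤₚ.i*j≡0⇒i≡0∨j≡0 i eq)

i*j≡0∧i≢0⇒j≡0 : ∀ i j → i * j ≡ + 0 → i ≢ + 0 → j ≡ + 0
i*j≡0∧i≢0⇒j≡0 i j eq i≢0 = [ ⊥-elim ∘ i≢0 , id ]′ (ℤₚ.i*j≡0⇒i≡0∨j≡0 i eq)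

i*i+j*j≡0⇒i≡0 : ∀ i j → i * i + j * j ≡ + 0 → i ≡ + 0
i*i+j*j≡0⇒i≡0 i j eq = ℤₚ.∣i∣≡0⇒i≡0 ([ id , id ]′ (ℕₚ.m*n≡0⇒m≡0∨n≡0 ∣ i ∣ ∣i∣²≡0))
  where
  open ≡-Reasoning
  ∣i∣²≡0 : ∣ i ∣ ℕ.* ∣ i ∣ ≡ 0
  ∣i∣²≡0 = ℕₚ.m+n≡0⇒m≡0 _ (ℤₚ.+-injective (begin
    + (∣ i ∣ ℕ.* ∣ i ∣ ℕ.+ ∣ j ∣ ℕ.* ∣ j ∣)   ≡⟨ ℤₚ.pos-+ (∣ i ∣ ℕ.* ∣ i ∣) _ ⟩
    + (∣ i ∣ ℕ.* ∣ i ∣) + + (∣ j ∣ ℕ.* ∣ j ∣)  ≡⟨ cong₂ _+_ (i*i≡+∣i∣*∣i∣ i) (i*i≡+∣i∣*∣i∣ j) ⟨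
    i * i + j * j                              ≡⟨ eq ⟩
    + 0                                        ∎))

i*i+j*j≡0⇒j≡0 : ∀ i j → i * i + j * j ≡ + 0 → j ≡ + 0
i*i+j*j≡0⇒j≡0 i j eq = i*i+j*j≡0⇒i≡0 j i (trans (ℤₚ.+-comm (j * j) (i * i)) eq)

positive-difference : ∀ {m n} → m < n → ∃[ w ] + n - + m ≡ + suc w
positive-difference {m} {n} m<n = pred (n ℕ.∸ m) , (begin
  + n - + m              ≡⟨ ℤₚ.[+m]-[+n]≡m⊖n n m ⟩
  n ℤ.⊖ m                ≡⟨ ℤₚ.⊖-≥ (ℕₚ.<⇒≤ m<n) ⟩
  + (n ℕ.∸ m)            ≡⟨ cong +_ (ℕₚ.suc-pred (n ℕ.∸ m)) ⟨
  + suc (pred (n ℕ.∸ m)) ∎)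
  where
  open ≡-Reasoning
  instance _ = ℕ.>-nonZero (ℕₚ.m<n⇒0<n∸m m<n)

negative-difference : ∀ {m n} → m < n → ∃[ w ] + m - + n ≡ -[1+ w ]
negative-difference {m} {n} m<n with positive-difference m<n
... | w , n-m≡1+w = w , (begin
  + m - + n    ≡⟨ ℤₚ.[+m]-[+n]≡m⊖n m n ⟩
  m ℤ.⊖ n      ≡⟨ ℤₚ.⊖-swap m n ⟩
  - (n ℤ.⊖ m)  ≡⟨ cong -_ (trans (sym (ℤₚ.[+m]-[+n]≡m⊖n n m)) n-m≡1+w) ⟩
  -[1+ w ]     ∎)
  where open ≡-Reasoning

+≢-[1+] : ∀ {m n} → + m ≢ -[1+ n ]
+≢-[1+] ()

4*i*i≡+ : ∀ i → + 4 * (i * i) ≡ + (4 ℕ.* (∣ i ∣ ℕ.* ∣ i ∣))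
4*i*i≡+ i = trans (cong (+ 4 *_) (i*i≡+∣i∣*∣i∣ i)) (sym (ℤₚ.pos-* 4 (∣ i ∣ ℕ.* ∣ i ∣)))

square≡product⇒≤ : ∀ {K d S} (c : ℤ) → K ≤ S →
                   + 4 * (c * c) ≡ (+ d - + K) * (+ S - + d) → K ≤ d
square≡product⇒≤ {K} {d} {S} c K≤S eq = ℕₚ.≮⇒≥ λ d<K →
  -- for d < K ≤ S the right-hand side is negative
  let w , d-K≡-[1+w] = negative-difference d<K
      z , S-d≡1+z    = positive-difference (ℕₚ.<-≤-trans d<K K≤S)
  in  +≢-[1+] (trans (sym (4*i*i≡+ c)) (trans eq (cong₂ _*_ d-K≡-[1+w] S-d≡1+z)))

n≤n*n : ∀ n → n ≤ n ℕ.* n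
n≤n*n zero    = ℕ.z≤n
n≤n*n (suc n) = ℕₚ.m≤m*n (suc n) (suc n)

m*m≤n*n⇒m≤n : ∀ m n → m ℕ.* m ≤ n ℕ.* n → m ≤ n
m*m≤n*n⇒m≤n m n m²≤n² = ℕₚ.≮⇒≥ λ n<m → ℕₚ.<⇒≱ (ℕₚ.*-mono-< n<m n<m) m²≤n²

linear-root-bound : ∀ X Y n → X * + n + Y ≡ + 0 → ∣ Y ∣ < n → X ≡ + 0 × Y ≡ + 0
linear-root-bound X Y n Xn+Y≡0 ∣Y∣<n = X≡0 , Y≡0
  where
  open ≡-Reasoning
  Xn≡-Y : X * + n ≡ - Y
  Xn≡-Y = begin
    X * + n             ≡⟨ cancel (X * + n) Y ⟩
    (X * + n + Y) - Y   ≡⟨ cong (_- Y) Xn+Y≡0 ⟩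
    + 0 - Y             ≡⟨ ℤₚ.+-identityˡ (- Y) ⟩
    - Y                 ∎
    where
    cancel : ∀ i j → i ≡ (i + j) - j
    cancel = solve-∀
  ∣X∣n≡∣Y∣ : ∣ X ∣ ℕ.* n ≡ ∣ Y ∣
  ∣X∣n≡∣Y∣ = begin
    ∣ X ∣ ℕ.* n  ≡⟨ ℤₚ.abs-* X (+ n) ⟨
    ∣ X * + n ∣  ≡⟨ cong ∣_∣ Xn≡-Y ⟩
    ∣ - Y ∣      ≡⟨ ℤₚ.∣-i∣≡∣i∣ Y ⟩
    ∣ Y ∣        ∎
  ∣X∣n<1n : ∣ X ∣ ℕ.* n < 1 ℕ.* n
  ∣X∣n<1n = subst₂ _<_ (sym ∣X∣n≡∣Y∣) (sym (ℕₚ.*-identityˡ n)) ∣Y∣<n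
  X≡0 : X ≡ + 0
  X≡0 = ℤₚ.∣i∣≡0⇒i≡0 (ℕₚ.n<1⇒n≡0 (ℕₚ.*-cancelʳ-< n ∣ X ∣ 1 ∣X∣n<1n))
  Y≡0 : Y ≡ + 0
  Y≡0 = begin
    Y            ≡⟨ ℤₚ.+-identityˡ Y ⟨
    + 0 + Y      ≡⟨ cong (λ X → X * + n + Y) X≡0 ⟨
    X * + n + Y  ≡⟨ Xn+Y≡0 ⟩
    + 0          ∎

quadratic-root-bound : ∀ X Y Z n → X * (+ n * + n) + Y * + n + Z ≡ + 0 → ∣ Y ∣ ℕ.+ ∣ Z ∣ < n →
                       X ≡ + 0 × Y ≡ + 0 × Z ≡ + 0
quadratic-root-bound X Y Z n eq ∣Y∣+∣Z∣<n =
  let X≡0 , Yn+Z≡0 = linear-root-bound X (Y * + n + Z) (n ℕ.* n) eq′ ∣Yn+Z∣<n²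
      Y≡0 , Z≡0    = linear-root-bound Y Z n Yn+Z≡0 (ℕₚ.≤-<-trans (ℕₚ.m≤n+m ∣ Z ∣ ∣ Y ∣) ∣Y∣+∣Z∣<n)
  in  X≡0 , Y≡0 , Z≡0
  where
  eq′ : X * + (n ℕ.* n) + (Y * + n + Z) ≡ + 0
  eq′ = begin
    X * + (n ℕ.* n) + (Y * + n + Z)    ≡⟨ cong (λ s → X * s + (Y * + n + Z)) (ℤₚ.pos-* n n) ⟩
    X * (+ n * + n) + (Y * + n + Z)    ≡⟨ ℤₚ.+-assoc (X * (+ n * + n)) (Y * + n) Z ⟨
    X * (+ n * + n) + Y * + n + Z      ≡⟨ eq ⟩
    + 0                                ∎
    where open ≡-Reasoning
  ∣Yn+Z∣<n² : ∣ Y * + n + Z ∣ < n ℕ.* n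
  ∣Yn+Z∣<n² = begin-strict
    ∣ Y * + n + Z ∣               ≤⟨ ℤₚ.∣i+j∣≤∣i∣+∣j∣ (Y * + n) Z ⟩
    ∣ Y * + n ∣ ℕ.+ ∣ Z ∣         ≡⟨ cong (ℕ._+ ∣ Z ∣) (ℤₚ.abs-* Y (+ n)) ⟩
    ∣ Y ∣ ℕ.* n ℕ.+ ∣ Z ∣         ≤⟨ ℕₚ.+-monoʳ-≤ (∣ Y ∣ ℕ.* n) (ℕₚ.m≤m*n ∣ Z ∣ n) ⟩
    ∣ Y ∣ ℕ.* n ℕ.+ ∣ Z ∣ ℕ.* n   ≡⟨ ℕₚ.*-distribʳ-+ n ∣ Y ∣ ∣ Z ∣ ⟨
    (∣ Y ∣ ℕ.+ ∣ Z ∣) ℕ.* n       <⟨ ℕₚ.*-monoˡ-< n ∣Y∣+∣Z∣<n ⟩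
    n ℕ.* n                       ∎
    where
    open ℕₚ.≤-Reasoning
    instance _ = ℕ.>-nonZero (ℕₚ.≤-<-trans ℕ.z≤n ∣Y∣+∣Z∣<n)

0<n*n : ∀ {n} → n ≢ 0 → 0 < n ℕ.* n
0<n*n {zero}  n≢0 = ⊥-elim (n≢0 refl)
0<n*n {suc _} _   = ℕ.z<s

-- Distances and Heron's formula

dist² : Point → Point → ℕ
dist² (px , py) (qx , qy) = ∣ qx - px ∣ ℕ.* ∣ qx - px ∣ ℕ.+ ∣ qy - py ∣ ℕ.* ∣ qy - py ∣

sqDist≡+dist² : ∀ P Q → sqDist P Q ≡ + dist² P Q
sqDist≡+dist² (px , py) (qx , qy) =
  trans (cong₂ _+_ (i*i≡+∣i∣*∣i∣ (qx - px)) (i*i≡+∣i∣*∣i∣ (qy - py)))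
        (sym (ℤₚ.pos-+ (∣ qx - px ∣ ℕ.* ∣ qx - px ∣) (∣ qy - py ∣ ℕ.* ∣ qy - py ∣)))

sqDist≡0⇒≡ : ∀ P Q → sqDist P Q ≡ + 0 → P ≡ Q
sqDist≡0⇒≡ (px , py) (qx , qy) eq =
  cong₂ _,_ (sym (ℤₚ.i-j≡0⇒i≡j qx px (i*i+j*j≡0⇒i≡0 (qx - px) (qy - py) eq)))
            (sym (ℤₚ.i-j≡0⇒i≡j qy py (i*i+j*j≡0⇒j≡0 (qx - px) (qy - py) eq)))

IntDist-refl : ∀ P → IntDist P P
IntDist-refl (x , y) = 0 , cong₂ (λ s t → s * s + t * t) (ℤₚ.+-inverseʳ x) (ℤₚ.+-inverseʳ y)

cross : Point → Point → Point → ℤ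
cross (ax , ay) (bx , by) (cx , cy) = (bx - ax) * (cy - ay) - (by - ay) * (cx - ax)

four-area²-identity : ∀ x₁ y₁ x₂ y₂ x y →
  let c = (x₂ - x₁) * (y - y₁) - (y₂ - y₁) * (x - x₁)
      A = (x - x₁) * (x - x₁) + (y - y₁) * (y - y₁)
      B = (x - x₂) * (x - x₂) + (y - y₂) * (y - y₂)
      D = (x₂ - x₁) * (x₂ - x₁) + (y₂ - y₁) * (y₂ - y₁)
  in  + 4 * (c * c) ≡ + 4 * (A * B) - (A + B - D) * (A + B - D)
four-area²-identity = solve-∀

gap : ℕ → ℕ → ℕ
gap a b = ∣ + a - + b ∣

gap≤a+b : ∀ a b → gap a b ≤ a ℕ.+ b
gap≤a+b a b = subst (λ z → ∣ z ∣ ≤ a ℕ.+ b) (sym (ℤₚ.[+m]-[+n]≡m⊖n a b))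
              (ℕₚ.≤-trans (ℤₚ.∣m⊝n∣≤m⊔n a b) (ℕₚ.m⊔n≤m+n a b))

gap≢0 : ∀ {a b} → a ≢ b → gap a b ≢ 0
gap≢0 {a} {b} a≢b g≡0 = a≢b (ℤₚ.+-injective (ℤₚ.i-j≡0⇒i≡j (+ a) (+ b) (ℤₚ.∣i∣≡0⇒i≡0 g≡0)))

sqDist≡+*+ : ∀ P Q (dPQ : IntDist P Q) → sqDist P Q ≡ + proj₁ dPQ * + proj₁ dPQ
sqDist≡+*+ P Q (n , e) = trans e (ℤₚ.pos-* n n)

module _ (P₁ P₂ Q : Point) (dA : IntDist P₁ Q) (dB : IntDist P₂ Q) where

  private
    a b d g S : ℕ
    a = proj₁ dA
    b = proj₁ dB
    d = dist² P₁ P₂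
    g = gap a b
    S = (a ℕ.+ b) ℕ.* (a ℕ.+ b)

  heron : + 4 * (cross P₁ P₂ Q * cross P₁ P₂ Q) ≡ (+ d - + (g ℕ.* g)) * (+ S - + d)
  heron = begin
    + 4 * (cross P₁ P₂ Q * cross P₁ P₂ Q)
      ≡⟨ four-area²-identity (proj₁ P₁) (proj₂ P₁) (proj₁ P₂) (proj₂ P₂) (proj₁ Q) (proj₂ Q) ⟩
    + 4 * (A * B) - (A + B - D) * (A + B - D)
      ≡⟨ cong₂ (λ A B → + 4 * (A * B) - (A + B - D) * (A + B - D)) (sqDist≡+*+ P₁ Q dA) (sqDist≡+*+ P₂ Q dB) ⟩
    + 4 * ((α * α) * (β * β)) - (α * α + β * β - D) * (α * α + β * β - D)
      ≡⟨ scalar-heron α β D ⟩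
    (D - (α - β) * (α - β)) * ((α + β) * (α + β) - D)
      ≡⟨ cong₂ (λ D K → (D - K) * ((α + β) * (α + β) - D)) (sqDist≡+dist² P₁ P₂) (i*i≡+∣i∣*∣i∣ (α - β)) ⟩
    (+ d - + (g ℕ.* g)) * ((α + β) * (α + β) - + d)
      ≡⟨ cong (λ S → (+ d - + (g ℕ.* g)) * (S - + d)) [α+β]²≡S ⟩
    (+ d - + (g ℕ.* g)) * (+ S - + d) ∎
    where
    open ≡-Reasoning
    α β A B D : ℤ
    α = + a
    β = + b
    A = sqDist P₁ Q
    B = sqDist P₂ Q
    D = sqDist P₁ P₂
    [α+β]²≡S : (α + β) * (α + β) ≡ + S
    [α+β]²≡S = sym (trans (ℤₚ.pos-* (a ℕ.+ b) (a ℕ.+ b)) (cong₂ _*_ (ℤₚ.pos-+ a b) (ℤₚ.pos-+ a b)))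
    scalar-heron : ∀ α β D → + 4 * ((α * α) * (β * β)) - (α * α + β * β - D) * (α * α + β * β - D)
                             ≡ (D - (α - β) * (α - β)) * ((α + β) * (α + β) - D)
    scalar-heron = solve-∀

  gap²≤dist² : g ℕ.* g ≤ d
  gap²≤dist² = square≡product⇒≤ {g ℕ.* g} {d} {S} (cross P₁ P₂ Q)
                 (ℕₚ.*-mono-≤ (gap≤a+b a b) (gap≤a+b a b)) heron

  gap²≡dist²⇒collinear : g ℕ.* g ≡ d → Collinear P₁ P₂ Q
  gap²≡dist²⇒collinear g²≡d =
    i*i≡0⇒i≡0 (cross P₁ P₂ Q) (i*j≡0∧i≢0⇒j≡0 (+ 4) (cross P₁ P₂ Q * cross P₁ P₂ Q) 4c²≡0 λ ())
    where
    open ≡-Reasoning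
    4c²≡0 : + 4 * (cross P₁ P₂ Q * cross P₁ P₂ Q) ≡ + 0
    4c²≡0 = begin
      + 4 * (cross P₁ P₂ Q * cross P₁ P₂ Q)   ≡⟨ heron ⟩
      (+ d - + (g ℕ.* g)) * (+ S - + d)        ≡⟨ cong (λ K → (+ d - + K) * (+ S - + d)) g²≡d ⟩
      (+ d - + d) * (+ S - + d)                ≡⟨ cong (_* (+ S - + d)) (ℤₚ.+-inverseʳ (+ d)) ⟩
      + 0                                      ∎

  collinear⇒IntDist : Collinear P₁ P₂ Q → IntDist P₁ P₂
  collinear⇒IntDist c≡0 =
    [ (λ d-g²≡0 → g , trans (sqDist≡+dist² P₁ P₂) (ℤₚ.i-j≡0⇒i≡j (+ d) (+ (g ℕ.* g)) d-g²≡0))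
    , (λ S-d≡0 → a ℕ.+ b , trans (sqDist≡+dist² P₁ P₂) (sym (ℤₚ.i-j≡0⇒i≡j (+ S) (+ d) S-d≡0)))
    ]′ (ℤₚ.i*j≡0⇒i≡0∨j≡0 (+ d - + (g ℕ.* g)) (trans (sym heron) (cong (λ c → + 4 * (c * c)) c≡0)))

-- Two points: hyperbolas

-- The conic (|QP₁|² − |QP₂|² − K)² = 4K|QP₂|², that is | |QP₁| − |QP₂| | = √K: for
-- 0 < K < |P₁P₂|² it is a hyperbola with foci P₁ and P₂.
hyperbola : Point → Point → ℤ → Conic
hyperbola (x₁ , y₁) (x₂ , y₂) K = conic
  (+ 4 * (x₂ - x₁) * (x₂ - x₁) - + 4 * K)
  (+ 8 * (x₂ - x₁) * (y₂ - y₁))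
  (+ 4 * (y₂ - y₁) * (y₂ - y₁) - + 4 * K)
  (+ 4 * (x₂ - x₁) * c₀ + + 8 * K * x₂)
  (+ 4 * (y₂ - y₁) * c₀ + + 8 * K * y₂)
  (c₀ * c₀ - + 4 * K * (x₂ * x₂ + y₂ * y₂))
  where c₀ = x₁ * x₁ + y₁ * y₁ - x₂ * x₂ - y₂ * y₂ - K

hyperbola-identities : ∀ x₁ y₁ x₂ y₂ K x y →
  let c₀ = x₁ * x₁ + y₁ * y₁ - x₂ * x₂ - y₂ * y₂ - K
      a = + 4 * (x₂ - x₁) * (x₂ - x₁) - + 4 * K
      b = + 8 * (x₂ - x₁) * (y₂ - y₁)
      c = + 4 * (y₂ - y₁) * (y₂ - y₁) - + 4 * K
      d = + 4 * (x₂ - x₁) * c₀ + + 8 * K * x₂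
      e = + 4 * (y₂ - y₁) * c₀ + + 8 * K * y₂
      f = c₀ * c₀ - + 4 * K * (x₂ * x₂ + y₂ * y₂)
      D = (x₂ - x₁) * (x₂ - x₁) + (y₂ - y₁) * (y₂ - y₁)
      A = (x - x₁) * (x - x₁) + (y - y₁) * (y - y₁)
      B = (x - x₂) * (x - x₂) + (y - y₂) * (y - y₂)
  in  (b * b - + 4 * a * c ≡ + 64 * K * (D - K))
    × (+ 2 * a * (+ 4 * c * f - e * e) - b * (+ 2 * b * f - d * e) + d * (b * e - + 2 * c * d)
         ≡ + 128 * (K * K) * ((D - K) * (D - K)))
    × (a * x * x + b * x * y + c * y * y + d * x + e * y + f ≡ (A - B - K) * (A - B - K) - + 4 * K * B)
hyperbola-identities x₁ y₁ x₂ y₂ K x y = solve vs , solve vs , solve vs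
  where vs = x₁ ∷ y₁ ∷ x₂ ∷ y₂ ∷ K ∷ x ∷ y ∷ []

hyperbola-isHyperbola : ∀ P₁ P₂ {K} → 0 < K → K < dist² P₁ P₂ → IsHyperbola (hyperbola P₁ P₂ (+ K))
hyperbola-isHyperbola P₁@(x₁ , y₁) P₂@(x₂ , y₂) {K} (ℕ.s≤s _) K<d =
  subst (+ 0 ℤ.<_) (sym discriminant) (ℤ.+<+ ℕ.z<s) , λ det≡0 → +[1+]≢0 (trans (sym determinant) det≡0)
  where
  open Conic (hyperbola P₁ P₂ (+ K))
  j : ℕ
  j = proj₁ (positive-difference K<d)
  D-K≡1+j : sqDist P₁ P₂ - + K ≡ + suc j
  D-K≡1+j = trans (cong (_- + K) (sqDist≡+dist² P₁ P₂)) (proj₂ (positive-difference K<d))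
  discriminant : b * b - + 4 * a * c ≡ + 64 * + K * + suc j
  discriminant = trans (proj₁ (hyperbola-identities x₁ y₁ x₂ y₂ (+ K) (+ 0) (+ 0)))
                       (cong (+ 64 * + K *_) D-K≡1+j)
  determinant : + 2 * a * (+ 4 * c * f - e * e) - b * (+ 2 * b * f - d * e) + d * (b * e - + 2 * c * d)
                ≡ + 128 * (+ K * + K) * (+ suc j * + suc j)
  determinant = trans (proj₁ (proj₂ (hyperbola-identities x₁ y₁ x₂ y₂ (+ K) (+ 0) (+ 0))))
                      (cong (λ z → + 128 * (+ K * + K) * (z * z)) D-K≡1+j)
  +[1+]≢0 : ∀ {n} → + suc n ≢ + 0
  +[1+]≢0 ()

hyperbolas : Point → Point → List Conic
hyperbolas P₁ P₂ = applyUpTo (λ i → hyperbola P₁ P₂ (+ suc i)) (pred (dist² P₁ P₂))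

All-IsHyperbola-hyperbolas : ∀ P₁ P₂ → All IsHyperbola (hyperbolas P₁ P₂)
All-IsHyperbola-hyperbolas P₁ P₂ = applyUpTo⁺₁ (λ i → hyperbola P₁ P₂ (+ suc i)) (pred (dist² P₁ P₂))
  λ {i} i<d-1 → hyperbola-isHyperbola P₁ P₂ ℕ.z<s (ℕₚ.pred-cancel-< {suc i} i<d-1)

Any-hyperbolas : ∀ P₁ P₂ {Q K} → 0 < K → K < dist² P₁ P₂ → OnConic (hyperbola P₁ P₂ (+ K)) Q →
                 Any (λ h → OnConic h Q) (hyperbolas P₁ P₂)
Any-hyperbolas P₁ P₂ {K = suc _} _ K<d onK =
  applyUpTo⁺ (λ i → hyperbola P₁ P₂ (+ suc i)) onK (ℕₚ.pred-mono-< K<d)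

module _ (P₁ P₂ Q : Point) (dA : IntDist P₁ Q) (dB : IntDist P₂ Q) where

  private
    g : ℕ
    g = gap (proj₁ dA) (proj₁ dB)
    α β K A B : ℤ
    α = + proj₁ dA
    β = + proj₁ dB
    K = + (g ℕ.* g)
    A = sqDist P₁ Q
    B = sqDist P₂ Q

  on-hyperbola : OnConic (hyperbola P₁ P₂ K) Q
  on-hyperbola = trans equation (begin
    (A - B - K) * (A - B - K) - + 4 * K * B
      ≡⟨ cong₂ (λ A B → (A - B - K) * (A - B - K) - + 4 * K * B) (sqDist≡+*+ P₁ Q dA) (sqDist≡+*+ P₂ Q dB) ⟩
    (α * α - β * β - K) * (α * α - β * β - K) - + 4 * K * (β * β)
      ≡⟨ cong (λ K → (α * α - β * β - K) * (α * α - β * β - K) - + 4 * K * (β * β)) K≡[α-β]² ⟩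
    (α * α - β * β - (α - β) * (α - β)) * (α * α - β * β - (α - β) * (α - β))
      - + 4 * ((α - β) * (α - β)) * (β * β)
      ≡⟨ vanishes α β ⟩
    + 0 ∎)
    where
    open ≡-Reasoning
    open Conic (hyperbola P₁ P₂ K)
    x y : ℤ
    x = proj₁ Q
    y = proj₂ Q
    equation : a * x * x + b * x * y + c * y * y + d * x + e * y + f ≡ (A - B - K) * (A - B - K) - + 4 * K * B
    equation = proj₂ (proj₂ (hyperbola-identities (proj₁ P₁) (proj₂ P₁) (proj₁ P₂) (proj₂ P₂) K x y))
    K≡[α-β]² : K ≡ (α - β) * (α - β)
    K≡[α-β]² = sym (i*i≡+∣i∣*∣i∣ (α - β))
    vanishes : ∀ α β → (α * α - β * β - (α - β) * (α - β)) * (α * α - β * β - (α - β) * (α - β))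
                         - + 4 * ((α - β) * (α - β)) * (β * β) ≡ + 0
    vanishes = solve-∀

  on-hyperbola-or-line : Any (λ h → OnConic h Q) (hyperbolas P₁ P₂) ⊎ Collinear P₁ P₂ Q ⊎ Equidistant P₁ P₂ Q
  on-hyperbola-or-line with proj₁ dA ℕ.≟ proj₁ dB
  ... | yes a≡b = inj₂ (inj₂ (trans (proj₂ dA) (trans (cong (λ n → + (n ℕ.* n)) a≡b) (sym (proj₂ dB)))))
  ... | no a≢b with g ℕ.* g ℕ.≟ dist² P₁ P₂
  ...   | yes g²≡d = inj₂ (inj₁ (gap²≡dist²⇒collinear P₁ P₂ Q dA dB g²≡d))
  ...   | no g²≢d = inj₁ (Any-hyperbolas P₁ P₂ (0<n*n (gap≢0 a≢b)) (ℕₚ.≤∧≢⇒< (gap²≤dist² P₁ P₂ Q dA dB) g²≢d)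
                                          on-hyperbola)

-- Boxes and decidability

≤-sum-map : ∀ {A : Set} (f : A → ℕ) {x xs} → x ∈ xs → f x ≤ sum (map f xs)
≤-sum-map f {xs = y ∷ ys} (here refl)  = ℕₚ.m≤m+n (f y) (sum (map f ys))
≤-sum-map f {xs = y ∷ ys} (there x∈ys) = ℕₚ.≤-trans (≤-sum-map f x∈ys) (ℕₚ.m≤n+m (sum (map f ys)) (f y))

interval : ℤ → ℕ → List ℤ
interval c N = applyUpTo (λ i → c - + N + + i) (suc (N ℕ.+ N))

N+t≡+i : ∀ {N} t → ∣ t ∣ ≤ N → ∃[ i ] (+ N + t ≡ + i) × i < suc (N ℕ.+ N)
N+t≡+i {N} (+ n)    n≤N   = N ℕ.+ n , sym (ℤₚ.pos-+ N n) , s≤s (ℕₚ.+-monoʳ-≤ N n≤N)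
N+t≡+i {N} -[1+ n ] 1+n≤N = N ℕ.∸ suc n
                          , trans (ℤₚ.m-n≡m⊖n N (suc n)) (ℤₚ.⊖-≥ 1+n≤N)
                          , s≤s (ℕₚ.≤-trans (ℕₚ.m∸n≤m N (suc n)) (ℕₚ.m≤m+n N N))

∈-interval : ∀ c N z → ∣ z - c ∣ ≤ N → z ∈ interval c N
∈-interval c N z ∣z-c∣≤N =
  let i , N+[z-c]≡+i , i<2N+1 = N+t≡+i (z - c) ∣z-c∣≤N in
  subst (_∈ interval c N) (trans (cong (λ j → c - + N + j) (sym N+[z-c]≡+i)) (recentre c (+ N) z))
        (∈-applyUpTo⁺ (λ i → c - + N + + i) i<2N+1)
  where
  recentre : ∀ c N z → c - N + (N + (z - c)) ≡ z
  recentre = solve-∀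

box : Point → ℕ → List Point
box (cx , cy) N = cartesianProduct (interval cx N) (interval cy N)

∈-box : ∀ C N Q → ∣ proj₁ Q - proj₁ C ∣ ≤ N → ∣ proj₂ Q - proj₂ C ∣ ≤ N → Q ∈ box C N
∈-box (cx , cy) N (x , y) ∣Δx∣≤N ∣Δy∣≤N =
  ∈-cartesianProduct⁺ (∈-interval cx N x ∣Δx∣≤N) (∈-interval cy N y ∣Δy∣≤N)

IntDist⇒∈box : ∀ C Q (dCQ : IntDist C Q) {N} → proj₁ dCQ ≤ N → Q ∈ box C N
IntDist⇒∈box C@(cx , cy) Q@(x , y) (a , e) a≤N =
  ∈-box C _ Q (ℕₚ.≤-trans (m*m≤n*n⇒m≤n ∣Δx∣ a (ℕₚ.≤-trans (ℕₚ.m≤m+n _ _) (ℕₚ.≤-reflexive Δ²≡a²))) a≤N)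
              (ℕₚ.≤-trans (m*m≤n*n⇒m≤n ∣Δy∣ a (ℕₚ.≤-trans (ℕₚ.m≤n+m _ _) (ℕₚ.≤-reflexive Δ²≡a²))) a≤N)
  where
  ∣Δx∣ ∣Δy∣ : ℕ
  ∣Δx∣ = ∣ x - cx ∣
  ∣Δy∣ = ∣ y - cy ∣
  Δ²≡a² : ∣Δx∣ ℕ.* ∣Δx∣ ℕ.+ ∣Δy∣ ℕ.* ∣Δy∣ ≡ a ℕ.* a
  Δ²≡a² = ℤₚ.+-injective (trans (sym (sqDist≡+dist² C Q)) e)

IntDist? : ∀ P Q → Dec (IntDist P Q)
IntDist? P Q = map′ (λ (k , _ , d≡k²) → k , trans (sqDist≡+dist² P Q) (cong +_ d≡k²))
                    (λ (k , e) → let d≡k² = ℤₚ.+-injective (trans (sym (sqDist≡+dist² P Q)) e) in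
                                 k , s≤s (ℕₚ.≤-trans (n≤n*n k) (ℕₚ.≤-reflexive (sym d≡k²))) , d≡k²)
                    (ℕₚ.anyUpTo? (λ k → dist² P Q ℕₚ.≟ k ℕ.* k) (suc (dist² P Q)))

InS? : ∀ {r} (P : Fin r → Point) Q → Dec (InS P Q)
InS? P Q = all? (λ i → IntDist? (P i) Q)

Collinear? : ∀ A B C → Dec (Collinear A B C)
Collinear? A B C = cross A B C ℤ.≟ + 0

-- Three points

polarization-identity : ∀ x₀ y₀ x₁ y₁ x y →
  + 2 * ((x - x₀) * (x₁ - x₀) + (y - y₀) * (y₁ - y₀))
  ≡ (x - x₀) * (x - x₀) + (y - y₀) * (y - y₀) - ((x - x₁) * (x - x₁) + (y - y₁) * (y - y₁))
    + ((x₁ - x₀) * (x₁ - x₀) + (y₁ - y₀) * (y₁ - y₀))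
polarization-identity = solve-∀

-- (e₁v₂ − e₂u₂, u₁e₂ − v₁e₁) = 2δq is Cramer's rule recovering q from e₁ = 2q·u and e₂ = 2q·v.
cramer-identities : ∀ u₁ u₂ v₁ v₂ q₁ q₂ →
  let Du = u₁ * u₁ + u₂ * u₂
      p  = u₁ * v₁ + u₂ * v₂
      δ  = u₁ * v₂ - u₂ * v₁
      e₁ = + 2 * (q₁ * u₁ + q₂ * u₂)
      e₂ = + 2 * (q₁ * v₁ + q₂ * v₂)
  in  (+ 4 * (δ * δ) * (q₁ * q₁ + q₂ * q₂)
         ≡ (e₁ * v₂ - e₂ * u₂) * (e₁ * v₂ - e₂ * u₂) + (u₁ * e₂ - v₁ * e₁) * (u₁ * e₂ - v₁ * e₁))
    × (Du * e₂ - p * e₁ ≡ + 2 * (δ * (q₂ * u₁ - q₁ * u₂)))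
cramer-identities u₁ u₂ v₁ v₂ q₁ q₂ = solve vs , solve vs
  where vs = u₁ ∷ u₂ ∷ v₁ ∷ v₂ ∷ q₁ ∷ q₂ ∷ []

coefficient-identities : ∀ u₁ u₂ v₁ v₂ k m α →
  let Du = u₁ * u₁ + u₂ * u₂
      Dv = v₁ * v₁ + v₂ * v₂
      p  = u₁ * v₁ + u₂ * v₂
      δ  = u₁ * v₂ - u₂ * v₁
      F  = Du - k * k
      G  = Dv - m * m
      W₁ = + 2 * (k * v₂ - m * u₂)
      W₂ = + 2 * (m * u₁ - k * v₁)
      Z₁ = F * v₂ - G * u₂
      Z₂ = u₁ * G - v₁ * F
      E₁ = + 2 * k * α + F
      E₂ = + 2 * m * α + G
  in  ((+ 4 * (δ * δ) - W₁ * W₁ - W₂ * W₂) * (α * α) + - (+ 2 * (W₁ * Z₁ + W₂ * Z₂)) * α + - (Z₁ * Z₁ + Z₂ * Z₂)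
         ≡ + 4 * (δ * δ) * (α * α)
           - ((E₁ * v₂ - E₂ * u₂) * (E₁ * v₂ - E₂ * u₂) + (u₁ * E₂ - v₁ * E₁) * (u₁ * E₂ - v₁ * E₁)))
    × (+ 2 * (Du * m - p * k) * α + (Du * G - p * F) ≡ Du * E₂ - p * E₁)
coefficient-identities u₁ u₂ v₁ v₂ k m α = solve vs , solve vs
  where vs = u₁ ∷ u₂ ∷ v₁ ∷ v₂ ∷ k ∷ m ∷ α ∷ []

degeneracy-identities : ∀ u₁ u₂ v₁ v₂ k m →
  let Du = u₁ * u₁ + u₂ * u₂
      Dv = v₁ * v₁ + v₂ * v₂
      p  = u₁ * v₁ + u₂ * v₂
      δ  = u₁ * v₂ - u₂ * v₁
      F  = Du - k * k
      G  = Dv - m * m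
      W₁ = + 2 * (k * v₂ - m * u₂)
      W₂ = + 2 * (m * u₁ - k * v₁)
      Z₁ = F * v₂ - G * u₂
      Z₂ = u₁ * G - v₁ * F
  in  (δ * F ≡ Z₁ * u₁ + Z₂ * u₂)
    × (δ * G ≡ Z₁ * v₁ + Z₂ * v₂)
    × (+ 4 * ((k * m - p) * (k * m - p)) ≡ + 4 * (F * G) - (+ 4 * (δ * δ) - W₁ * W₁ - W₂ * W₂))
    × (δ * δ ≡ (k * m - p) * (k * m + p) + F * G + F * (m * m) + G * (k * k))
    × (p * F * (p - Du) ≡ (Du * G - p * F) * Du - (δ * δ) * Du + (Du * m - p * k) * (Du * m + p * k))
degeneracy-identities u₁ u₂ v₁ v₂ k m = solve vs , solve vs , solve vs , solve vs , solve vs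
  where vs = u₁ ∷ u₂ ∷ v₁ ∷ v₂ ∷ k ∷ m ∷ []

lagrange-identity : ∀ u₁ u₂ v₁ v₂ →
  (u₁ * v₁ + u₂ * v₂) * (u₁ * v₁ + u₂ * v₂) + (u₁ * v₂ - u₂ * v₁) * (u₁ * v₂ - u₂ * v₁)
  ≡ (u₁ * u₁ + u₂ * u₂) * (v₁ * v₁ + v₂ * v₂)
lagrange-identity = solve-∀

decomposition-identities : ∀ x₀ y₀ x₁ y₁ x₂ y₂ →
  let u₁ = x₁ - x₀
      u₂ = y₁ - y₀
      v₁ = x₂ - x₀
      v₂ = y₂ - y₀
      Du = u₁ * u₁ + u₂ * u₂
      p  = u₁ * v₁ + u₂ * v₂
      δ  = u₁ * v₂ - u₂ * v₁
  in  (Du * (x₂ - x₁) ≡ (p - Du) * u₁ - δ * u₂) × (Du * (y₂ - y₁) ≡ (p - Du) * u₂ + δ * u₁)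
decomposition-identities x₀ y₀ x₁ y₁ x₂ y₂ = solve vs , solve vs
  where vs = x₀ ∷ y₀ ∷ x₁ ∷ y₁ ∷ x₂ ∷ y₂ ∷ []

dot-from-distances : ∀ A B Q (dA : IntDist A Q) (dB : IntDist B Q) →
  let α = + proj₁ dA
      k = α - + proj₁ dB
  in  + 2 * ((proj₁ Q - proj₁ A) * (proj₁ B - proj₁ A) + (proj₂ Q - proj₂ A) * (proj₂ B - proj₂ A))
      ≡ + 2 * k * α + (sqDist A B - k * k)
dot-from-distances A B Q dA dB = begin
  _                                           ≡⟨ polarization-identity (proj₁ A) (proj₂ A) (proj₁ B) (proj₂ B) (proj₁ Q) (proj₂ Q) ⟩
  sqDist A Q - sqDist B Q + sqDist A B        ≡⟨ cong₂ (λ s t → s - t + sqDist A B) (sqDist≡+*+ A Q dA) (sqDist≡+*+ B Q dB) ⟩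
  α * α - β * β + sqDist A B                  ≡⟨ difference-of-squares α β (sqDist A B) ⟩
  + 2 * (α - β) * α + (sqDist A B - (α - β) * (α - β)) ∎
  where
  open ≡-Reasoning
  α β : ℤ
  α = + proj₁ dA
  β = + proj₁ dB
  difference-of-squares : ∀ α β D → α * α - β * β + D ≡ + 2 * (α - β) * α + (D - (α - β) * (α - β))
  difference-of-squares = solve-∀

-- u = B − A and v = C − A, with Du = |u|², Dv = |v|², p = u·v and δ = u × v, so Collinear A B C is
-- δ ≡ 0. For k = |AQ| − |BQ| and m = |AQ| − |CQ| the dot products 2u·(Q − A) and 2v·(Q − A) are
-- 2kα + F k and 2mα + G m, α = |AQ|; qA, qB, qC and lB, lC are the coefficients of the quadratic and
-- (for δ = 0) linear equations in α obtained by eliminating Q − A, and (Z₁, Z₂) is the Cramer vector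
-- of (F k, G m).
module Configuration (A B C : Point) where

  u₁ u₂ v₁ v₂ Du Dv p δ : ℤ
  u₁ = proj₁ B - proj₁ A
  u₂ = proj₂ B - proj₂ A
  v₁ = proj₁ C - proj₁ A
  v₂ = proj₂ C - proj₂ A
  Du = u₁ * u₁ + u₂ * u₂
  Dv = v₁ * v₁ + v₂ * v₂
  p  = u₁ * v₁ + u₂ * v₂
  δ  = u₁ * v₂ - u₂ * v₁

  F G : ℤ → ℤ
  F k = Du - k * k
  G m = Dv - m * m

  W₁ W₂ Z₁ Z₂ qA qB qC lB lC : ℤ → ℤ → ℤ
  W₁ k m = + 2 * (k * v₂ - m * u₂)
  W₂ k m = + 2 * (m * u₁ - k * v₁)
  Z₁ k m = F k * v₂ - G m * u₂
  Z₂ k m = u₁ * G m - v₁ * F k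
  qA k m = + 4 * (δ * δ) - W₁ k m * W₁ k m - W₂ k m * W₂ k m
  qB k m = - (+ 2 * (W₁ k m * Z₁ k m + W₂ k m * Z₂ k m))
  qC k m = - (Z₁ k m * Z₁ k m + Z₂ k m * Z₂ k m)
  lB k m = + 2 * (Du * m - p * k)
  lC k m = Du * G m - p * F k

  -- qC = −|Z|², and Z = 0 determines F and G by Cramer's rule when δ ≢ 0.
  noncollinear∧qC≡0⇒F≡0×G≡0 : ∀ k m → δ ≢ + 0 → qC k m ≡ + 0 → F k ≡ + 0 × G m ≡ + 0
  noncollinear∧qC≡0⇒F≡0×G≡0 k m δ≢0 qC≡0 =
      i*j≡0∧i≢0⇒j≡0 δ (F k) (trans δF≡Z·u (cong₂ (λ z₁ z₂ → z₁ * u₁ + z₂ * u₂) Z₁≡0 Z₂≡0)) δ≢0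
    , i*j≡0∧i≢0⇒j≡0 δ (G m) (trans δG≡Z·v (cong₂ (λ z₁ z₂ → z₁ * v₁ + z₂ * v₂) Z₁≡0 Z₂≡0)) δ≢0
    where
    δF≡Z·u : δ * F k ≡ Z₁ k m * u₁ + Z₂ k m * u₂
    δF≡Z·u = proj₁ (degeneracy-identities u₁ u₂ v₁ v₂ k m)
    δG≡Z·v : δ * G m ≡ Z₁ k m * v₁ + Z₂ k m * v₂
    δG≡Z·v = proj₁ (proj₂ (degeneracy-identities u₁ u₂ v₁ v₂ k m))
    Z²≡0 : Z₁ k m * Z₁ k m + Z₂ k m * Z₂ k m ≡ + 0
    Z²≡0 = ℤₚ.neg-injective qC≡0
    Z₁≡0 : Z₁ k m ≡ + 0
    Z₁≡0 = i*i+j*j≡0⇒i≡0 (Z₁ k m) (Z₂ k m) Z²≡0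
    Z₂≡0 : Z₂ k m ≡ + 0
    Z₂≡0 = i*i+j*j≡0⇒j≡0 (Z₁ k m) (Z₂ k m) Z²≡0

  -- With F = G = 0, qA = −4(km − p)² and δ² = (km − p)(km + p).
  noncollinear⇒nondegenerate : ∀ k m → δ ≢ + 0 → qA k m ≡ + 0 → qC k m ≡ + 0 → ⊥
  noncollinear⇒nondegenerate k m δ≢0 qA≡0 qC≡0 = δ≢0 (i*i≡0⇒i≡0 δ δ²≡0)
    where
    open ≡-Reasoning
    F≡0 : F k ≡ + 0
    F≡0 = proj₁ (noncollinear∧qC≡0⇒F≡0×G≡0 k m δ≢0 qC≡0)
    G≡0 : G m ≡ + 0
    G≡0 = proj₂ (noncollinear∧qC≡0⇒F≡0×G≡0 k m δ≢0 qC≡0)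
    4[km-p]²≡ : + 4 * ((k * m - p) * (k * m - p)) ≡ + 4 * (F k * G m) - qA k m
    4[km-p]²≡ = proj₁ (proj₂ (proj₂ (degeneracy-identities u₁ u₂ v₁ v₂ k m)))
    km-p≡0 : k * m - p ≡ + 0
    km-p≡0 = i*i≡0⇒i≡0 (k * m - p) (i*j≡0∧i≢0⇒j≡0 (+ 4) ((k * m - p) * (k * m - p))
               (trans 4[km-p]²≡ (cong₂ (λ f a → + 4 * (f * G m) - a) F≡0 qA≡0)) λ ())
    δ²≡0 : δ * δ ≡ + 0
    δ²≡0 = begin
      δ * δ
        ≡⟨ proj₁ (proj₂ (proj₂ (proj₂ (degeneracy-identities u₁ u₂ v₁ v₂ k m)))) ⟩
      (k * m - p) * (k * m + p) + F k * G m + F k * (m * m) + G m * (k * k)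
        ≡⟨ cong₂ (λ f g → (k * m - p) * (k * m + p) + f * g + f * (m * m) + g * (k * k)) F≡0 G≡0 ⟩
      (k * m - p) * (k * m + p) + + 0 + + 0 + + 0
        ≡⟨ cong (λ x → x * (k * m + p) + + 0 + + 0 + + 0) km-p≡0 ⟩
      + 0 ∎

  collinear⇒p≢0 : δ ≡ + 0 → A ≢ B → A ≢ C → p ≢ + 0
  collinear⇒p≢0 δ≡0 A≢B A≢C p≡0 =
    [ A≢B ∘ sqDist≡0⇒≡ A B , A≢C ∘ sqDist≡0⇒≡ A C ]′ (ℤₚ.i*j≡0⇒i≡0∨j≡0 Du DuDv≡0)
    where
    DuDv≡0 : Du * Dv ≡ + 0
    DuDv≡0 = trans (sym (lagrange-identity u₁ u₂ v₁ v₂)) (cong₂ (λ p d → p * p + d * d) p≡0 δ≡0)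

  collinear⇒p≢Du : δ ≡ + 0 → A ≢ B → B ≢ C → p - Du ≢ + 0
  collinear⇒p≢Du δ≡0 A≢B B≢C p-Du≡0 =
    B≢C (cong₂ _,_ (sym (ℤₚ.i-j≡0⇒i≡j (proj₁ C) (proj₁ B) Δx≡0)) (sym (ℤₚ.i-j≡0⇒i≡j (proj₂ C) (proj₂ B) Δy≡0)))
    where
    Du≢0 : Du ≢ + 0
    Du≢0 = A≢B ∘ sqDist≡0⇒≡ A B
    Δx≡0 : proj₁ C - proj₁ B ≡ + 0
    Δx≡0 = i*j≡0∧i≢0⇒j≡0 Du (proj₁ C - proj₁ B)
             (trans (proj₁ (decomposition-identities (proj₁ A) (proj₂ A) (proj₁ B) (proj₂ B) (proj₁ C) (proj₂ C)))
                    (cong₂ (λ w d → w * u₁ - d * u₂) p-Du≡0 δ≡0)) Du≢0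
    Δy≡0 : proj₂ C - proj₂ B ≡ + 0
    Δy≡0 = i*j≡0∧i≢0⇒j≡0 Du (proj₂ C - proj₂ B)
             (trans (proj₂ (decomposition-identities (proj₁ A) (proj₂ A) (proj₁ B) (proj₂ B) (proj₁ C) (proj₂ C)))
                    (cong₂ (λ w d → w * u₂ + d * u₁) p-Du≡0 δ≡0)) Du≢0

  collinear∧linear-degenerate⇒F≡0 : ∀ k m → δ ≡ + 0 → A ≢ B → A ≢ C → B ≢ C →
                                    lB k m ≡ + 0 → lC k m ≡ + 0 → F k ≡ + 0
  collinear∧linear-degenerate⇒F≡0 k m δ≡0 A≢B A≢C B≢C lB≡0 lC≡0 =
    i*j≡0∧i≢0⇒j≡0 p (F k) (i*j≡0∧i≢0⇒j≡0 (p - Du) (p * F k) (trans (ℤₚ.*-comm (p - Du) (p * F k)) pF[p-Du]≡0)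
                             (collinear⇒p≢Du δ≡0 A≢B B≢C))
                  (collinear⇒p≢0 δ≡0 A≢B A≢C)
    where
    open ≡-Reasoning
    Dum-pk≡0 : Du * m - p * k ≡ + 0
    Dum-pk≡0 = i*j≡0∧i≢0⇒j≡0 (+ 2) (Du * m - p * k) lB≡0 λ ()
    pF[p-Du]≡0 : p * F k * (p - Du) ≡ + 0
    pF[p-Du]≡0 = begin
      p * F k * (p - Du)
        ≡⟨ proj₂ (proj₂ (proj₂ (proj₂ (degeneracy-identities u₁ u₂ v₁ v₂ k m)))) ⟩
      lC k m * Du - (δ * δ) * Du + (Du * m - p * k) * (Du * m + p * k)
        ≡⟨ cong₂ (λ l d → l * Du - (d * d) * Du + (Du * m - p * k) * (Du * m + p * k)) lC≡0 δ≡0 ⟩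
      + 0 + (Du * m - p * k) * (Du * m + p * k)
        ≡⟨ cong (λ x → + 0 + x * (Du * m + p * k)) Dum-pk≡0 ⟩
      + 0 ∎

  coefficient-bound : ℤ × ℤ → ℕ
  coefficient-bound (k , m) = ∣ qB k m ∣ ℕ.+ ∣ qC k m ∣ ℕ.+ (∣ lB k m ∣ ℕ.+ ∣ lC k m ∣)

  -- Bounds |AQ| for every admissible (k, m), which the triangle inequality confines to a box.
  radius : ℕ
  radius = sum (map coefficient-bound (box (+ 0 , + 0) (dist² A B ℕ.+ dist² A C)))

  coefficient-bound≤radius : ∀ k m → ∣ k ∣ ≤ dist² A B → ∣ m ∣ ≤ dist² A C → coefficient-bound (k , m) ≤ radius
  coefficient-bound≤radius k m ∣k∣≤AB ∣m∣≤AC = ≤-sum-map coefficient-bound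
    (∈-box (+ 0 , + 0) R (k , m) (centred k (ℕₚ.≤-trans ∣k∣≤AB (ℕₚ.m≤m+n (dist² A B) (dist² A C))))
                                 (centred m (ℕₚ.≤-trans ∣m∣≤AC (ℕₚ.m≤n+m (dist² A C) (dist² A B)))))
    where
    R : ℕ
    R = dist² A B ℕ.+ dist² A C
    centred : ∀ i → ∣ i ∣ ≤ R → ∣ i - + 0 ∣ ≤ R
    centred i = subst (λ j → ∣ j ∣ ≤ R) (sym (ℤₚ.+-identityʳ i))

  module _ (Q : Point) (dA : IntDist A Q) (dB : IntDist B Q) (dC : IntDist C Q) where

    private
      a : ℕ
      a = proj₁ dA
      α k m q₁ q₂ e₁ e₂ : ℤ
      α = + a
      k = α - + proj₁ dB
      m = α - + proj₁ dC
      q₁ = proj₁ Q - proj₁ A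
      q₂ = proj₂ Q - proj₂ A
      e₁ = + 2 * (q₁ * u₁ + q₂ * u₂)
      e₂ = + 2 * (q₁ * v₁ + q₂ * v₂)
      e₁≡ : e₁ ≡ + 2 * k * α + F k
      e₁≡ = dot-from-distances A B Q dA dB
      e₂≡ : e₂ ≡ + 2 * m * α + G m
      e₂≡ = dot-from-distances A C Q dA dC

    quadratic-equation : qA k m * (α * α) + qB k m * α + qC k m ≡ + 0
    quadratic-equation = begin
      qA k m * (α * α) + qB k m * α + qC k m
        ≡⟨ proj₁ (coefficient-identities u₁ u₂ v₁ v₂ k m α) ⟩
      + 4 * (δ * δ) * (α * α) - cramer² (+ 2 * k * α + F k) (+ 2 * m * α + G m)
        ≡⟨ cong₂ (λ E₁ E₂ → + 4 * (δ * δ) * (α * α) - cramer² E₁ E₂) e₁≡ e₂≡ ⟨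
      + 4 * (δ * δ) * (α * α) - cramer² e₁ e₂
        ≡⟨ cong (λ s → + 4 * (δ * δ) * s - cramer² e₁ e₂) (sqDist≡+*+ A Q dA) ⟨
      + 4 * (δ * δ) * (q₁ * q₁ + q₂ * q₂) - cramer² e₁ e₂
        ≡⟨ cong (_- cramer² e₁ e₂) (proj₁ (cramer-identities u₁ u₂ v₁ v₂ q₁ q₂)) ⟩
      cramer² e₁ e₂ - cramer² e₁ e₂
        ≡⟨ ℤₚ.+-inverseʳ (cramer² e₁ e₂) ⟩
      + 0 ∎
      where
      open ≡-Reasoning
      cramer² : ℤ → ℤ → ℤ
      cramer² E₁ E₂ = (E₁ * v₂ - E₂ * u₂) * (E₁ * v₂ - E₂ * u₂) + (u₁ * E₂ - v₁ * E₁) * (u₁ * E₂ - v₁ * E₁)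

    linear-equation : δ ≡ + 0 → lB k m * α + lC k m ≡ + 0
    linear-equation δ≡0 = begin
      lB k m * α + lC k m                                 ≡⟨ proj₂ (coefficient-identities u₁ u₂ v₁ v₂ k m α) ⟩
      Du * (+ 2 * m * α + G m) - p * (+ 2 * k * α + F k)  ≡⟨ cong₂ (λ E₁ E₂ → Du * E₂ - p * E₁) e₁≡ e₂≡ ⟨
      Du * e₂ - p * e₁                                    ≡⟨ proj₂ (cramer-identities u₁ u₂ v₁ v₂ q₁ q₂) ⟩
      + 2 * (δ * (q₂ * u₁ - q₁ * u₂))                     ≡⟨ cong (λ d → + 2 * (d * (q₂ * u₁ - q₁ * u₂))) δ≡0 ⟩
      + 0                                                 ∎
      where open ≡-Reasoning

    private
      ∣k∣≤dist²AB : ∣ k ∣ ≤ dist² A B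
      ∣k∣≤dist²AB = ℕₚ.≤-trans (n≤n*n ∣ k ∣) (gap²≤dist² A B Q dA dB)
      ∣m∣≤dist²AC : ∣ m ∣ ≤ dist² A C
      ∣m∣≤dist²AC = ℕₚ.≤-trans (n≤n*n ∣ m ∣) (gap²≤dist² A C Q dA dC)
      bound≤radius : coefficient-bound (k , m) ≤ radius
      bound≤radius = coefficient-bound≤radius k m ∣k∣≤dist²AB ∣m∣≤dist²AC

    noncollinear⇒bounded : δ ≢ + 0 → a ≤ coefficient-bound (k , m)
    noncollinear⇒bounded δ≢0 = ℕₚ.≮⇒≥ λ bound<a →
      let qA≡0 , _ , qC≡0 = quadratic-root-bound (qA k m) (qB k m) (qC k m) a quadratic-equation
                              (ℕₚ.≤-<-trans (ℕₚ.m≤m+n (∣ qB k m ∣ ℕ.+ ∣ qC k m ∣) (∣ lB k m ∣ ℕ.+ ∣ lC k m ∣)) bound<a)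
      in  noncollinear⇒nondegenerate k m δ≢0 qA≡0 qC≡0

    collinear⇒bounded-or-on-line : δ ≡ + 0 → A ≢ B → A ≢ C → B ≢ C → a ≤ coefficient-bound (k , m) ⊎ Collinear A B Q
    collinear⇒bounded-or-on-line δ≡0 A≢B A≢C B≢C with a ≤? coefficient-bound (k , m)
    ... | yes a≤bound = inj₁ a≤bound
    ... | no  a≰bound = inj₂ (gap²≡dist²⇒collinear A B Q dA dB gap²≡dist²)
      where
      ∣lC∣<a : ∣ lC k m ∣ < a
      ∣lC∣<a = ℕₚ.≤-<-trans (ℕₚ.≤-trans (ℕₚ.m≤n+m ∣ lC k m ∣ ∣ lB k m ∣)
                                        (ℕₚ.m≤n+m (∣ lB k m ∣ ℕ.+ ∣ lC k m ∣) (∣ qB k m ∣ ℕ.+ ∣ qC k m ∣)))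
                              (ℕₚ.≰⇒> a≰bound)
      lB≡0×lC≡0 : lB k m ≡ + 0 × lC k m ≡ + 0
      lB≡0×lC≡0 = linear-root-bound (lB k m) (lC k m) a (linear-equation δ≡0) ∣lC∣<a
      F≡0 : F k ≡ + 0
      F≡0 = collinear∧linear-degenerate⇒F≡0 k m δ≡0 A≢B A≢C B≢C (proj₁ lB≡0×lC≡0) (proj₂ lB≡0×lC≡0)
      gap²≡dist² : ∣ k ∣ ℕ.* ∣ k ∣ ≡ dist² A B
      gap²≡dist² = ℤₚ.+-injective (trans (sym (i*i≡+∣i∣*∣i∣ k))
                                  (trans (sym (ℤₚ.i-j≡0⇒i≡j Du (k * k) F≡0)) (sqDist≡+dist² A B)))

    noncollinear⇒∈box : ¬ Collinear A B C → Q ∈ box A radius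
    noncollinear⇒∈box ¬ABC = IntDist⇒∈box A Q dA (ℕₚ.≤-trans (noncollinear⇒bounded ¬ABC) bound≤radius)

    collinear⇒∈box-or-on-line : Collinear A B C → A ≢ B → A ≢ C → B ≢ C → Q ∈ box A radius ⊎ Collinear A B Q
    collinear⇒∈box-or-on-line ABC A≢B A≢C B≢C =
      [ (λ a≤bound → inj₁ (IntDist⇒∈box A Q dA (ℕₚ.≤-trans a≤bound bound≤radius))) , inj₂ ]′
      (collinear⇒bounded-or-on-line ABC A≢B A≢C B≢C)

-- The set S for three or more points

idx1≢idx2 : ∀ {r} (hr : 3 ≤ r) → idx1 hr ≢ idx2 hr
idx1≢idx2 (s≤s (s≤s (s≤s _))) ()

third-index : ∀ {r} → 3 ≤ r → (i j : Fin r) → ∃[ k ] k ≢ i × k ≢ j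
third-index (s≤s (s≤s (s≤s _))) zero          zero          = suc zero , (λ ()) , (λ ())
third-index (s≤s (s≤s (s≤s _))) zero          (suc zero)    = suc (suc zero) , (λ ()) , (λ ())
third-index (s≤s (s≤s (s≤s _))) zero          (suc (suc _)) = suc zero , (λ ()) , (λ ())
third-index (s≤s (s≤s (s≤s _))) (suc zero)    zero          = suc (suc zero) , (λ ()) , (λ ())
third-index (s≤s (s≤s (s≤s _))) (suc (suc _)) zero          = suc zero , (λ ()) , (λ ())
third-index (s≤s (s≤s (s≤s _))) (suc _)       (suc _)       = zero , (λ ()) , (λ ())

module _ {r : ℕ} (hr : 3 ≤ r) (P : Fin r → Point) (P-injective : Injective _≡_ _≡_ P) where

  AllCollinear AllIntegral ExplicitS : Set
  AllCollinear = (i j k : Fin r) → Collinear (P i) (P j) (P k)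
  AllIntegral  = (i j : Fin r) → IntDist (P i) (P j)
  ExplicitS    = Σ[ L ∈ List Point ] ((Q : Point) → (InS P Q → Q ∈ L) × (Q ∈ L → InS P Q))

  bounded⇒explicit : ∀ C N → ((Q : Point) → InS P Q → Q ∈ box C N) → ExplicitS
  bounded⇒explicit C N S⊆box = filter (InS? P) (box C N) , λ Q →
    (λ Q∈S → ∈-filter⁺ (InS? P) (S⊆box Q Q∈S) Q∈S) , (λ Q∈L → proj₂ (∈-filter⁻ (InS? P) {xs = box C N} Q∈L))

  noncollinear-case : ∀ i j k → ¬ Collinear (P i) (P j) (P k) → ExplicitS
  noncollinear-case i j k ¬ijk = bounded⇒explicit (P i) radius λ Q Q∈S →
    noncollinear⇒∈box Q (Q∈S i) (Q∈S j) (Q∈S k) ¬ijk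
    where open Configuration (P i) (P j) (P k)

  distinct-third : ∀ i j → ∃[ k ] P i ≢ P k × P j ≢ P k
  distinct-third i j =
    let k , k≢i , k≢j = third-index hr i j in k , k≢i ∘ sym ∘ P-injective , k≢j ∘ sym ∘ P-injective

  nonintegral-case : AllCollinear → ∀ i j → ¬ IntDist (P i) (P j) → ExplicitS
  nonintegral-case collinear i j ¬ij = bounded⇒explicit (P i) radius λ Q Q∈S →
    [ id , ⊥-elim ∘ ¬ij ∘ collinear⇒IntDist (P i) (P j) Q (Q∈S i) (Q∈S j) ]′
      (collinear⇒∈box-or-on-line Q (Q∈S i) (Q∈S j) (Q∈S k) (collinear i j k) Pi≢Pj Pi≢Pk Pj≢Pk)
    where
    Pi≢Pj : P i ≢ P j
    Pi≢Pj Pi≡Pj = ¬ij (subst (IntDist (P i)) Pi≡Pj (IntDist-refl (P i)))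
    k : Fin r
    k = proj₁ (distinct-third i j)
    Pi≢Pk : P i ≢ P k
    Pi≢Pk = proj₁ (proj₂ (distinct-third i j))
    Pj≢Pk : P j ≢ P k
    Pj≢Pk = proj₂ (proj₂ (distinct-third i j))
    open Configuration (P i) (P j) (P k)

  collinear-or-witness : AllCollinear ⊎ ∃[ i ] ∃[ j ] ∃[ k ] ¬ Collinear (P i) (P j) (P k)
  collinear-or-witness with any? (λ i → any? (λ j → any? (λ k → ¬? (Collinear? (P i) (P j) (P k)))))
  ... | yes witness = inj₂ witness
  ... | no ∄witness = inj₁ λ i j k →
    decidable-stable (Collinear? (P i) (P j) (P k)) (λ ¬ijk → ∄witness (i , j , k , ¬ijk))

  integral-or-witness : AllIntegral ⊎ ∃[ i ] ∃[ j ] ¬ IntDist (P i) (P j)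
  integral-or-witness with any? (λ i → any? (λ j → ¬? (IntDist? (P i) (P j))))
  ... | yes witness = inj₂ witness
  ... | no ∄witness = inj₁ λ i j →
    decidable-stable (IntDist? (P i) (P j)) (λ ¬ij → ∄witness (i , j , ¬ij))

  explicit-unless-collinear-integral : ¬ (AllCollinear × AllIntegral) → ExplicitS
  explicit-unless-collinear-integral ¬both =
    [ (λ collinear → [ ⊥-elim ∘ ¬both ∘ (collinear ,_)
                     , (λ (i , j , ¬ij) → nonintegral-case collinear i j ¬ij)
                     ]′ integral-or-witness)
    , (λ (i , j , k , ¬ijk) → noncollinear-case i j k ¬ijk)
    ]′ collinear-or-witness

  on-line-or-finite : AllCollinear →
    Σ[ L ∈ List Point ] ((Q : Point) → InS P Q → Collinear (P (idx1 hr)) (P (idx2 hr)) Q ⊎ Q ∈ L)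
  on-line-or-finite collinear = box (P i₁) radius , λ Q Q∈S →
    swap (collinear⇒∈box-or-on-line Q (Q∈S i₁) (Q∈S i₂) (Q∈S k) (collinear i₁ i₂ k)
           (idx1≢idx2 hr ∘ P-injective) (proj₁ (proj₂ (distinct-third i₁ i₂))) (proj₂ (proj₂ (distinct-third i₁ i₂))))
    where
    i₁ i₂ k : Fin r
    i₁ = idx1 hr
    i₂ = idx2 hr
    k = proj₁ (distinct-third i₁ i₂)
    open Configuration (P i₁) (P i₂) (P k)

proposition1p1 :
    ((P₁ P₂ : Point) → P₁ ≢ P₂ →
      Σ[ H ∈ List Conic ]
        (All IsHyperbola H) ×
        ((Q : Point) → IntDist P₁ Q → IntDist P₂ Q →
          Any (λ h → OnConic h Q) H ⊎ Collinear P₁ P₂ Q ⊎ Equidistant P₁ P₂ Q))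
    ×
    ((r : ℕ) (hr : 3 ≤ r) (P : Fin r → Point) → Injective _≡_ _≡_ P →
      (¬ (((i j k : Fin r) → Collinear (P i) (P j) (P k)) ×
          ((i j : Fin r) → IntDist (P i) (P j))) →
        Σ[ L ∈ List Point ] ((Q : Point) → (InS P Q → Q ∈ L) × (Q ∈ L → InS P Q)))
      ×
      ((((i j k : Fin r) → Collinear (P i) (P j) (P k)) ×
          ((i j : Fin r) → IntDist (P i) (P j))) →
        Σ[ L ∈ List Point ] ((Q : Point) → InS P Q →
          Collinear (P (idx1 hr)) (P (idx2 hr)) Q ⊎ Q ∈ L)))
proposition1p1 =
    (λ P₁ P₂ _ → hyperbolas P₁ P₂ , All-IsHyperbola-hyperbolas P₁ P₂ , on-hyperbola-or-line P₁ P₂)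
  , λ r hr P P-injective → explicit-unless-collinear-integral hr P P-injective
                         , on-line-or-finite hr P P-injective ∘ proj₁
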